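{- Let $L$ be any one of the sequent calculi $\mathrm{sC3}$, $\mathrm{sMC}$, $\mathrm{sCN}$. Then the rule (cut) is admissible in cut-free $L$. That is, for all finite sets $\Gamma,\Sigma$ of formulas and all formulas $\alpha,\gamma$: if $\Gamma\Rightarrow\alpha$ and $\alpha,\Sigma\Rightarrow\gamma$ are both provable in $L-(\mathrm{cut})$, then $\Gamma,\Sigma\Rightarrow\gamma$ is provable in $L-(\mathrm{cut})$.
   Context: Formulas are built from countably many propositional variables $p,q,\dots$ using the binary connectives $\land,\lor,\to$ and the unary connective $\sim$. A sequent is an expression $\Gamma\Rightarrow\gamma$ with $\Gamma$ a finite (possibly empty) set of formulas and $\gamma$ a single formula; $\alpha,\Gamma$ means $\{\alpha\}\cup\Gamma$ and $\Gamma,\Delta$ means $\Gamma\cup\Delta$. The calculus $\mathrm{sC}$ has the following initial sequents and rules ($p$ any propositional variable; $\alpha,\beta,\gamma$ any formulas; $\Gamma,\Delta,\Sigma$ any finite sets of formulas). Initial sequents: (init1) $p,\Gamma\Rightarrow p$; (init2) $\sim p,\Gamma\Rightarrow\sim p$. (cut): from $\Gamma\Rightarrow\alpha$ and $\alpha,\Sigma\Rightarrow\gamma$ infer $\Gamma,\Sigma\Rightarrow\gamma$. ($\to$left): from $\Gamma\Rightarrow\alpha$ and $\beta,\Delta\Rightarrow\gamma$ infer $\alpha\to\beta,\Gamma,\Delta\Rightarrow\gamma$. ($\to$right): from $\alpha,\Gamma\Rightarrow\beta$ infer $\Gamma\Rightarrow\alpha\to\beta$. ($\land$left): from $\alpha,\beta,\Gamma\Rightarrow\gamma$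 infer $\alpha\land\beta,\Gamma\Rightarrow\gamma$. ($\land$right): from $\Gamma\Rightarrow\alpha$ and $\Gamma\Rightarrow\beta$ infer $\Gamma\Rightarrow\alpha\land\beta$. ($\lor$left): from $\alpha,\Gamma\Rightarrow\gamma$ and $\beta,\Gamma\Rightarrow\gamma$ infer $\alpha\lor\beta,\Gamma\Rightarrow\gamma$. ($\lor$right1), ($\lor$right2): from $\Gamma\Rightarrow\alpha$ (respectively $\Gamma\Rightarrow\beta$) infer $\Gamma\Rightarrow\alpha\lor\beta$. ($\sim$left): from $\alpha,\Gamma\Rightarrow\gamma$ infer $\sim\sim\alpha,\Gamma\Rightarrow\gamma$. ($\sim$right): from $\Gamma\Rightarrow\alpha$ infer $\Gamma\Rightarrow\sim\sim\alpha$. ($\sim\to$left): from $\Gamma\Rightarrow\alpha$ and $\sim\beta,\Delta\Rightarrow\gamma$ infer $\sim(\alpha\to\beta),\Gamma,\Delta\Rightarrow\gamma$. ($\sim\to$right): from $\alpha,\Gamma\Rightarrow\sim\beta$ infer $\Gamma\Rightarrow\sim(\alpha\to\beta)$. ($\sim\land$left): from $\sim\alpha,\Gamma\Rightarrow\gamma$ and $\sim\beta,\Gamma\Rightarrow\gamma$ infer $\sim(\alpha\land\beta),\Gamma\Rightarrow\gamma$. ($\sim\land$right1), ($\sim\land$right2): from $\Gamma\Rightarrow\sim\alpha$ (respectively $\Gamma\Rightarrow\sim\beta$) infer $\Gamma\Rightarrow\sim(\alpha\land\beta)$. ($\sim\lor$left): from $\sim\alpha,\sim\beta,\Gamma\Rightarrow\gamma$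 infer $\sim(\alpha\lor\beta),\Gamma\Rightarrow\gamma$. ($\sim\lor$right): from $\Gamma\Rightarrow\sim\alpha$ and $\Gamma\Rightarrow\sim\beta$ infer $\Gamma\Rightarrow\sim(\alpha\lor\beta)$. Additional rules: (ex-middle): from $\sim\alpha,\Gamma\Rightarrow\gamma$ and $\alpha,\Gamma\Rightarrow\gamma$ infer $\Gamma\Rightarrow\gamma$. (Peirce): from $\alpha\to\beta,\Gamma\Rightarrow\alpha$ infer $\Gamma\Rightarrow\alpha$. $\mathrm{sC3}=\mathrm{sC}+$(ex-middle); $\mathrm{sMC}=\mathrm{sC}+$(Peirce); $\mathrm{sCN}=\mathrm{sC3}+$(Peirce). "Cut-free $L$", written $L-(\mathrm{cut})$, is $L$ without the rule (cut). A rule is admissible in a calculus if, for every instance of it, provability of all premises in the calculus implies provability of the conclusion in the calculus. -}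

module Defs where

open import Data.Empty using (⊥)
open import Data.List.Base using (List; []; _∷_; _++_)
open import Data.List.Relation.Binary.BagAndSetEquality using (_∼[_]_; set)
open import Data.List.Relation.Unary.All using (All)
open import Data.Nat.Base using (ℕ)
open import Data.Unit.Base using (⊤)
open import Function.Related.Propositional using (K-trans)
open import Level using (0ℓ)
open import Relation.Unary using (Pred; _∈_; _∪_; _∖_; ｛_｝)

infix  9 ∼_
infixr 8 _∧_
infixr 7 _∨_
infixr 6 _⟶_
infix  4 _⇒_
infix  3 _⊢_

data Formula : Set where
  var         : ℕ → Formula
  _∧_ _∨_ _⟶_ : Formula → Formula → Formula
  ∼_          : Formula → Formula

-- The antecedent is a finite set represented by a list of its elements, in any
-- order and with any repetitions; set union is _++_, and {α} ∪ Γ is α ∷ Γ.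
-- Lists with the same elements are identified in the definition of _⊢_.
record Sequent : Set where
  constructor _⇒_
  field
    antecedent : List Formula
    succedent  : Formula

data Rule : Set where
  init1 init2 cut            : Rule
  ⟶left ⟶right               : Rule
  ∧left ∧right               : Rule
  ∨left ∨right1 ∨right2      : Rule
  ∼left ∼right               : Rule
  ∼⟶left ∼⟶right             : Rule
  ∼∧left ∼∧right1 ∼∧right2   : Rule
  ∼∨left ∼∨right             : Rule
  ex-middle Peirce           : Rule

-- Instance r Ss S: the premises Ss and the conclusion S form an instance of r.
data Instance : Rule → List Sequent → Sequent → Set where

  init1   : ∀ {p Γ} → Instance init1 [] (var p ∷ Γ ⇒ var p)

  init2   : ∀ {p Γ} → Instance init2 [] (∼ var p ∷ Γ ⇒ ∼ var p)

  cut     : ∀ {α γ Γ Σ} →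
            Instance cut ((Γ ⇒ α) ∷ (α ∷ Σ ⇒ γ) ∷ []) (Γ ++ Σ ⇒ γ)

  ⟶left   : ∀ {α β γ Γ Δ} →
            Instance ⟶left ((Γ ⇒ α) ∷ (β ∷ Δ ⇒ γ) ∷ [])
                           ((α ⟶ β) ∷ Γ ++ Δ ⇒ γ)

  ⟶right  : ∀ {α β Γ} →
            Instance ⟶right ((α ∷ Γ ⇒ β) ∷ []) (Γ ⇒ α ⟶ β)

  ∧left   : ∀ {α β γ Γ} →
            Instance ∧left ((α ∷ β ∷ Γ ⇒ γ) ∷ []) ((α ∧ β) ∷ Γ ⇒ γ)

  ∧right  : ∀ {α β Γ} →
            Instance ∧right ((Γ ⇒ α) ∷ (Γ ⇒ β) ∷ []) (Γ ⇒ α ∧ β)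

  ∨left   : ∀ {α β γ Γ} →
            Instance ∨left ((α ∷ Γ ⇒ γ) ∷ (β ∷ Γ ⇒ γ) ∷ [])
                           ((α ∨ β) ∷ Γ ⇒ γ)

  ∨right1 : ∀ {α β Γ} → Instance ∨right1 ((Γ ⇒ α) ∷ []) (Γ ⇒ α ∨ β)

  ∨right2 : ∀ {α β Γ} → Instance ∨right2 ((Γ ⇒ β) ∷ []) (Γ ⇒ α ∨ β)

  ∼left   : ∀ {α γ Γ} →
            Instance ∼left ((α ∷ Γ ⇒ γ) ∷ []) (∼ ∼ α ∷ Γ ⇒ γ)

  ∼right  : ∀ {α Γ} → Instance ∼right ((Γ ⇒ α) ∷ []) (Γ ⇒ ∼ ∼ α)

  ∼⟶left  : ∀ {α β γ Γ Δ} →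
            Instance ∼⟶left ((Γ ⇒ α) ∷ (∼ β ∷ Δ ⇒ γ) ∷ [])
                            (∼ (α ⟶ β) ∷ Γ ++ Δ ⇒ γ)

  ∼⟶right : ∀ {α β Γ} →
            Instance ∼⟶right ((α ∷ Γ ⇒ ∼ β) ∷ []) (Γ ⇒ ∼ (α ⟶ β))

  ∼∧left  : ∀ {α β γ Γ} →
            Instance ∼∧left ((∼ α ∷ Γ ⇒ γ) ∷ (∼ β ∷ Γ ⇒ γ) ∷ [])
                            (∼ (α ∧ β) ∷ Γ ⇒ γ)

  ∼∧right1 : ∀ {α β Γ} →
             Instance ∼∧right1 ((Γ ⇒ ∼ α) ∷ []) (Γ ⇒ ∼ (α ∧ β))

  ∼∧right2 : ∀ {α β Γ} →
             Instance ∼∧right2 ((Γ ⇒ ∼ β) ∷ []) (Γ ⇒ ∼ (α ∧ β))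

  ∼∨left  : ∀ {α β γ Γ} →
            Instance ∼∨left ((∼ α ∷ ∼ β ∷ Γ ⇒ γ) ∷ []) (∼ (α ∨ β) ∷ Γ ⇒ γ)

  ∼∨right : ∀ {α β Γ} →
            Instance ∼∨right ((Γ ⇒ ∼ α) ∷ (Γ ⇒ ∼ β) ∷ []) (Γ ⇒ ∼ (α ∨ β))

  ex-middle : ∀ {α γ Γ} →
              Instance ex-middle ((∼ α ∷ Γ ⇒ γ) ∷ (α ∷ Γ ⇒ γ) ∷ []) (Γ ⇒ γ)

  Peirce  : ∀ {α β Γ} →
            Instance Peirce (((α ⟶ β) ∷ Γ ⇒ α) ∷ []) (Γ ⇒ α)

Calculus : Set₁
Calculus = Pred Rule 0ℓ

sC : Calculus
sC ex-middle = ⊥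
sC Peirce    = ⊥
sC _         = ⊤

sC3 sMC sCN : Calculus
sC3 = sC  ∪ ｛ ex-middle ｝
sMC = sC  ∪ ｛ Peirce ｝
sCN = sC3 ∪ ｛ Peirce ｝

cut-free : Calculus → Calculus
cut-free L = L ∖ ｛ cut ｝

-- Provability. The list Γ of the rule instance may be replaced by any list Δ
-- that represents the same set.
data _⊢_ (L : Calculus) : Sequent → Set where
  infer : ∀ {r Ss Γ Δ γ} → r ∈ L → Instance r Ss (Γ ⇒ γ) →
          Γ ∼[ set ] Δ → All (L ⊢_) Ss → L ⊢ Δ ⇒ γ

-- Hence provability depends only on the set that a list represents, also in
-- the premises of a rule.
⊢-resp-set : ∀ {L Γ Δ γ} → Γ ∼[ set ] Δ → L ⊢ Γ ⇒ γ → L ⊢ Δ ⇒ γ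
⊢-resp-set Γ∼Δ (infer r∈L inst Θ∼Γ ps) =
  infer r∈L inst (K-trans Θ∼Γ Γ∼Δ) ps

Admissible : Rule → Calculus → Set
Admissible r L = ∀ {Ss S} → Instance r Ss S → All (L ⊢_) Ss → L ⊢ S

{-# OPTIONS --safe #-}

-- Cuts are pushed to the introductions of the cut formula α on the left and
-- then to its uses on the right.  The only obstacle is Peirce on the left, with
-- premise α ⟶ β, Γ ⇒ α: permuting the cut turns it into Peirce for the
-- succedent γ of the right premise, so the hypothesis α ⟶ β has to become
-- γ ⟶ β.  Hence the induction on the left derivation replaces, simultaneously,
-- the succedent α by γ and hypotheses α ⟶ β by γ ⟶ β.  A use of α ⟶ β
-- has a premise with succedent α, which the same replacement turns into one
-- with succedent γ, as a use of γ ⟶ β requires.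
module Submission where

open import Defs
open import Data.Empty using (⊥-elim)
open import Data.List.Base using (List; []; _∷_; _++_)
open import Data.List.Membership.Propositional using (_∈_)
open import Data.List.Membership.Propositional.Properties using (∈-++⁻)
open import Data.List.Relation.Binary.BagAndSetEquality using (_∼[_]_; set)
open import Data.List.Relation.Binary.Subset.Propositional using (_⊆_)
open import Data.List.Relation.Binary.Subset.Propositional.Properties
  using (∷⁺ʳ; xs⊆xs++ys; xs⊆ys++xs)
open import Data.List.Relation.Unary.All using ([]; _∷_)
open import Data.List.Relation.Unary.Any using (here; there)
open import Data.Product.Base using (_×_; _,_; proj₁)
open import Data.Sum.Base using (_⊎_; inj₁; inj₂; [_,_]′)
open import Data.Unit.Base using (tt)
open import Function.Base using (_∘_; id)
open import Function.Bundles using (mk⇔; module Equivalence)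
open import Function.Related.Propositional using (K-refl)
open import Induction.WellFounded using (Acc; acc; WellFounded)
open import Relation.Binary.PropositionalEquality
  using (_≡_; _≢_; refl; sym; trans; subst)

private
  variable
    α β γ δ δ′ ε ε′ φ ψ : Formula
    Γ Δ Θ : List Formula

-- Shapes of formulas and the well-founded component order

data Shape : Set where
  atom           : Shape
  conj disj impl : Formula → Formula → Shape

-- ∼ ∼ α is classified as α ∧ α: for antecedents that are sets both have the
-- same rules.
shape : Formula → Shape
shape (var p)       = atom
shape (φ ∧ ψ)       = conj φ ψ
shape (φ ∨ ψ)       = disj φ ψ
shape (φ ⟶ ψ)       = impl φ ψ
shape (∼ var p)     = atom
shape (∼ (φ ∧ ψ))   = disj (∼ φ) (∼ ψ)
shape (∼ (φ ∨ ψ))   = conj (∼ φ) (∼ ψ)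
shape (∼ (φ ⟶ ψ))   = impl φ (∼ ψ)
shape (∼ ∼ φ)       = conj φ φ

components : Shape → List Formula
components atom       = []
components (conj φ ψ) = φ ∷ ψ ∷ []
components (disj φ ψ) = φ ∷ ψ ∷ []
components (impl φ ψ) = φ ∷ ψ ∷ []

-- This is not the subformula order: `∼ (φ ∧ ψ)` has the components `∼ φ` and `∼ ψ`.
_≺_ : Formula → Formula → Set
φ ≺ ψ = φ ∈ components (shape ψ)

∈⇒≺ : ∀ {s} → shape ψ ≡ s → φ ∈ components s → φ ≺ ψ
∈⇒≺ refl φ∈s = φ∈s

acc₂ : components (shape ε) ≡ φ ∷ ψ ∷ [] → Acc _≺_ φ → Acc _≺_ ψ → Acc _≺_ ε
acc₂ {ε} {φ} {ψ} eq accφ accψ = acc (below ∘ subst (_ ∈_) eq)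
  where
  below : δ ∈ φ ∷ ψ ∷ [] → Acc _≺_ δ
  below (here refl)         = accφ
  below (there (here refl)) = accψ

-- A component of a negation may itself be a negation, so φ and ∼ φ are treated
-- together to keep the recursion structural.
≺-wellFounded-± : ∀ φ → Acc _≺_ φ × Acc _≺_ (∼ φ)
≺-wellFounded-± (var p) = acc (λ ()) , acc (λ ())
≺-wellFounded-± (φ ∧ ψ) with ≺-wellFounded-± φ | ≺-wellFounded-± ψ
... | φ⁺ , φ⁻ | ψ⁺ , ψ⁻ = acc₂ refl φ⁺ ψ⁺ , acc₂ refl φ⁻ ψ⁻
≺-wellFounded-± (φ ∨ ψ) with ≺-wellFounded-± φ | ≺-wellFounded-± ψ
... | φ⁺ , φ⁻ | ψ⁺ , ψ⁻ = acc₂ refl φ⁺ ψ⁺ , acc₂ refl φ⁻ ψ⁻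
≺-wellFounded-± (φ ⟶ ψ) with ≺-wellFounded-± φ | ≺-wellFounded-± ψ
... | φ⁺ , φ⁻ | ψ⁺ , ψ⁻ = acc₂ refl φ⁺ ψ⁺ , acc₂ refl φ⁺ ψ⁻
≺-wellFounded-± (∼ φ) with ≺-wellFounded-± φ
... | φ⁺ , φ⁻ = φ⁻ , acc₂ refl φ⁺ φ⁺

≺-wellFounded : WellFounded _≺_
≺-wellFounded = proj₁ ∘ ≺-wellFounded-±

-- Antecedents as sets

absorb : α ∈ Γ → (α ∷ Γ) ∼[ set ] Γ
absorb α∈Γ = mk⇔ (λ { (here refl) → α∈Γ ; (there x) → x }) there

absorb-++ : α ∈ Γ → (α ∷ Γ ++ Γ) ∼[ set ] Γ
absorb-++ {Γ = Γ} α∈Γ = mk⇔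
  (λ { (here refl) → α∈Γ ; (there x) → [ id , id ]′ (∈-++⁻ Γ x) })
  (there ∘ xs⊆xs++ys Γ Γ)

∷-⊆-swap : Γ ⊆ α ∷ Θ → φ ∷ Γ ⊆ α ∷ φ ∷ Θ
∷-⊆-swap Γ⊆ (here refl) = there (here refl)
∷-⊆-swap Γ⊆ (there x) with Γ⊆ x
... | here refl = here refl
... | there y   = there (there y)

-- A Kleene-style calculus and its weakening

module CutElimination (L : Calculus) (sC⊆L : ∀ {r} → sC r → L r) where

  infix 3 _▷_ _▷ᴿ_

  -- Kleene style: principal formulas are retained in the premises.
  mutual
    data _▷_ (Γ : List Formula) : Formula → Set where
      right : Γ ▷ᴿ γ → Γ ▷ γ
      conjᴸ : α ∈ Γ → shape α ≡ conj φ ψ → φ ∷ ψ ∷ Γ ▷ γ → Γ ▷ γ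
      disjᴸ : α ∈ Γ → shape α ≡ disj φ ψ → φ ∷ Γ ▷ γ → ψ ∷ Γ ▷ γ → Γ ▷ γ
      implᴸ : α ∈ Γ → shape α ≡ impl φ ψ → Γ ▷ φ → ψ ∷ Γ ▷ γ → Γ ▷ γ
      exm   : L ex-middle → ∼ α ∷ Γ ▷ γ → α ∷ Γ ▷ γ → Γ ▷ γ
      prc   : L Peirce → (γ ⟶ β) ∷ Γ ▷ γ → Γ ▷ γ

    -- A separate type isolates the derivations whose last step introduces the succedent; these are
    -- the left premises of principal cuts.
    data _▷ᴿ_ (Γ : List Formula) (γ : Formula) : Set where
      atomᴿ  : shape γ ≡ atom → γ ∈ Γ → Γ ▷ᴿ γ
      conjᴿ  : shape γ ≡ conj φ ψ → Γ ▷ φ → Γ ▷ ψ → Γ ▷ᴿ γ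
      disjᴿ₁ : shape γ ≡ disj φ ψ → Γ ▷ φ → Γ ▷ᴿ γ
      disjᴿ₂ : shape γ ≡ disj φ ψ → Γ ▷ ψ → Γ ▷ᴿ γ
      implᴿ  : shape γ ≡ impl φ ψ → φ ∷ Γ ▷ ψ → Γ ▷ᴿ γ

  mutual
    weaken : Γ ⊆ Δ → Γ ▷ γ → Δ ▷ γ
    weaken s (right i)       = right (weakenᴿ s i)
    weaken s (conjᴸ x e d)   = conjᴸ (s x) e (weaken (∷⁺ʳ _ (∷⁺ʳ _ s)) d)
    weaken s (disjᴸ x e d f) =
      disjᴸ (s x) e (weaken (∷⁺ʳ _ s) d) (weaken (∷⁺ʳ _ s) f)
    weaken s (implᴸ x e d f) = implᴸ (s x) e (weaken s d) (weaken (∷⁺ʳ _ s) f)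
    weaken s (exm m d f)     = exm m (weaken (∷⁺ʳ _ s) d) (weaken (∷⁺ʳ _ s) f)
    weaken s (prc m d)       = prc m (weaken (∷⁺ʳ _ s) d)

    weakenᴿ : Γ ⊆ Δ → Γ ▷ᴿ γ → Δ ▷ᴿ γ
    weakenᴿ s (atomᴿ e x)   = atomᴿ e (s x)
    weakenᴿ s (conjᴿ e d f) = conjᴿ e (weaken s d) (weaken s f)
    weakenᴿ s (disjᴿ₁ e d)  = disjᴿ₁ e (weaken s d)
    weakenᴿ s (disjᴿ₂ e d)  = disjᴿ₂ e (weaken s d)
    weakenᴿ s (implᴿ e d)   = implᴿ e (weaken (∷⁺ʳ _ s) d)

  weaken₁ : Γ ▷ γ → φ ∷ Γ ▷ γ
  weaken₁ = weaken there

  weaken₁ᴿ : Γ ▷ᴿ γ → φ ∷ Γ ▷ᴿ γ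
  weaken₁ᴿ = weakenᴿ there

  -- Cuts whose left premise introduces the cut formula

  CutOn : Formula → Set
  CutOn α = ∀ {Γ γ} → Γ ▷ α → α ∷ Γ ▷ γ → Γ ▷ γ

  module _ (cut≺ : ∀ {φ} → φ ≺ α → CutOn φ) where

    -- Since `α` has only one shape, the right rule must match the left one, and the cut reduces to
    -- cuts on components, available from `cut≺`.
    cut-conj : shape α ≡ conj φ ψ → Θ ▷ᴿ α → φ ∷ ψ ∷ Θ ▷ γ → Θ ▷ γ
    cut-conj e (conjᴿ e′ d₁ d₂) f with trans (sym e) e′
    ... | refl = cut≺ (∈⇒≺ e (there (here refl))) d₂
                   (cut≺ (∈⇒≺ e (here refl)) (weaken₁ d₁) f)
    cut-conj e (atomᴿ e′ _)  _ with () ← trans (sym e) e′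
    cut-conj e (disjᴿ₁ e′ _) _ with () ← trans (sym e) e′
    cut-conj e (disjᴿ₂ e′ _) _ with () ← trans (sym e) e′
    cut-conj e (implᴿ e′ _)  _ with () ← trans (sym e) e′

    cut-disj : shape α ≡ disj φ ψ → Θ ▷ᴿ α → φ ∷ Θ ▷ γ → ψ ∷ Θ ▷ γ → Θ ▷ γ
    cut-disj e (disjᴿ₁ e′ d) f₁ f₂ with trans (sym e) e′
    ... | refl = cut≺ (∈⇒≺ e (here refl)) d f₁
    cut-disj e (disjᴿ₂ e′ d) f₁ f₂ with trans (sym e) e′
    ... | refl = cut≺ (∈⇒≺ e (there (here refl))) d f₂
    cut-disj e (atomᴿ e′ _)   _ _ with () ← trans (sym e) e′
    cut-disj e (conjᴿ e′ _ _) _ _ with () ← trans (sym e) e′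
    cut-disj e (implᴿ e′ _)   _ _ with () ← trans (sym e) e′

    cut-impl : shape α ≡ impl φ ψ → Θ ▷ᴿ α → Θ ▷ φ → ψ ∷ Θ ▷ γ → Θ ▷ γ
    cut-impl e (implᴿ e′ d) f₁ f₂ with trans (sym e) e′
    ... | refl = cut≺ (∈⇒≺ e (there (here refl)))
                   (cut≺ (∈⇒≺ e (here refl)) f₁ d) f₂
    cut-impl e (atomᴿ e′ _)   _ _ with () ← trans (sym e) e′
    cut-impl e (conjᴿ e′ _ _) _ _ with () ← trans (sym e) e′
    cut-impl e (disjᴿ₁ e′ _)  _ _ with () ← trans (sym e) e′
    cut-impl e (disjᴿ₂ e′ _)  _ _ with () ← trans (sym e) e′

    mutual
      -- Induction on the right premise. An inclusion instead of `Γ ≡ α ∷ Θ` lets new hypotheses be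
      -- added in front of `α` without an exchange rule.
      principal-cut : Θ ▷ᴿ α → Γ ⊆ α ∷ Θ → Γ ▷ γ → Θ ▷ γ
      principal-cut i s (right j) = principal-cutᴿ i s j
      principal-cut i s (conjᴸ x e d)
        -- The premise may still contain `α`; the recursive call removes it before the components
        -- are cut.
        with s x | principal-cut (weaken₁ᴿ (weaken₁ᴿ i)) (∷-⊆-swap (∷-⊆-swap s)) d
      ... | here refl | d′ = cut-conj e i d′
      ... | there y   | d′ = conjᴸ y e d′
      principal-cut i s (disjᴸ x e d f)
        with s x | principal-cut (weaken₁ᴿ i) (∷-⊆-swap s) d
                 | principal-cut (weaken₁ᴿ i) (∷-⊆-swap s) f
      ... | here refl | d′ | f′ = cut-disj e i d′ f′
      ... | there y   | d′ | f′ = disjᴸ y e d′ f′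
      principal-cut i s (implᴸ x e d f)
        with s x | principal-cut i s d
                 | principal-cut (weaken₁ᴿ i) (∷-⊆-swap s) f
      ... | here refl | d′ | f′ = cut-impl e i d′ f′
      ... | there y   | d′ | f′ = implᴸ y e d′ f′
      principal-cut i s (exm m d f) =
        exm m (principal-cut (weaken₁ᴿ i) (∷-⊆-swap s) d)
              (principal-cut (weaken₁ᴿ i) (∷-⊆-swap s) f)
      principal-cut i s (prc m d) =
        prc m (principal-cut (weaken₁ᴿ i) (∷-⊆-swap s) d)

      principal-cutᴿ : Θ ▷ᴿ α → Γ ⊆ α ∷ Θ → Γ ▷ᴿ γ → Θ ▷ γ
      principal-cutᴿ i s (atomᴿ e x) with s x
      ... | here refl = right i
      ... | there y   = right (atomᴿ e y)
      principal-cutᴿ i s (conjᴿ e d f) =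
        right (conjᴿ e (principal-cut i s d) (principal-cut i s f))
      principal-cutᴿ i s (disjᴿ₁ e d) = right (disjᴿ₁ e (principal-cut i s d))
      principal-cutᴿ i s (disjᴿ₂ e d) = right (disjᴿ₂ e (principal-cut i s d))
      principal-cutᴿ i s (implᴿ e d) =
        right (implᴿ e (principal-cut (weaken₁ᴿ i) (∷-⊆-swap s) d))

  -- Permuting cuts through the left premise

  module _ {α γ : Formula}
           (principal : ∀ {Θ} → Θ ▷ᴿ α → α ∷ Θ ▷ γ → Θ ▷ γ) where

    -- A relation and not a function, since a succedent `α` is replaced in some sequents of the
    -- derivation and kept in others, such as premises of right rules.
    data _↝_ : Formula → Formula → Set where
      keep    : δ ↝ δ
      replace : α ↝ γ

    -- Only implications can change, as only Peirce adds hypotheses that mention the succedent being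
    -- replaced.
    data Image (Θ : List Formula) : Formula → Set where
      same     : φ ∈ Θ → Image Θ φ
      replaced : ε ↝ ε′ → (ε′ ⟶ β) ∈ Θ → Image Θ (ε ⟶ β)

    _↝*_ : List Formula → List Formula → Set
    Γ ↝* Θ = ∀ {φ} → φ ∈ Γ → Image Θ φ

    Image-weaken : Image Θ φ → Image (ψ ∷ Θ) φ
    Image-weaken (same x)       = same (there x)
    Image-weaken (replaced t x) = replaced t (there x)

    ↝*-extend : Γ ↝* Θ → (ψ ∷ Γ) ↝* (ψ ∷ Θ)
    ↝*-extend s (here refl) = same (here refl)
    ↝*-extend s (there x)   = Image-weaken (s x)

    ↝*-extend-⟶ : ε ↝ ε′ → Γ ↝* Θ → ((ε ⟶ β) ∷ Γ) ↝* ((ε′ ⟶ β) ∷ Θ)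
    ↝*-extend-⟶ t s (here refl) = replaced t (here refl)
    ↝*-extend-⟶ t s (there x)   = Image-weaken (s x)

    weaken-behind : α ∷ Θ ▷ γ → α ∷ ψ ∷ Θ ▷ γ
    weaken-behind = weaken (∷⁺ʳ α there)

    mutual
      left-cut : α ∷ Θ ▷ γ → Γ ↝* Θ → δ ↝ δ′ → Γ ▷ δ → Θ ▷ δ′
      left-cut g s keep    (right i) = right (left-cutᴿ g s i)
      -- The only place where a cut is performed: `α` has just been introduced on the right.
      left-cut g s replace (right i) = principal (left-cutᴿ g s i) g
      left-cut g s t (conjᴸ x e d) with s x
      ... | same y = conjᴸ y e
              (left-cut (weaken-behind (weaken-behind g)) (↝*-extend (↝*-extend s)) t d)
      ... | replaced _ _ with () ← e
      left-cut g s t (disjᴸ x e d f) with s x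
      ... | same y = disjᴸ y e (left-cut (weaken-behind g) (↝*-extend s) t d)
                               (left-cut (weaken-behind g) (↝*-extend s) t f)
      ... | replaced _ _ with () ← e
      left-cut g s t (implᴸ x e d f) with s x
      ... | same y = implᴸ y e (left-cut g s keep d)
                               (left-cut (weaken-behind g) (↝*-extend s) t f)
      -- The premise proving `ε` is transformed along the same `u : ε ↝ ε′` as the implication, so
      -- it proves the antecedent of `ε′ ⟶ β`.
      ... | replaced u y with refl ← e =
              implᴸ y refl (left-cut g s u d)
                           (left-cut (weaken-behind g) (↝*-extend s) t f)
      left-cut g s t (exm m d f) =
        exm m (left-cut (weaken-behind g) (↝*-extend s) t d)
              (left-cut (weaken-behind g) (↝*-extend s) t f)
      left-cut g s t (prc m d) =
        -- Succedent and Peirce hypothesis change together, so the result is again an instance of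
        -- Peirce, now for `δ′`.
        prc m (left-cut (weaken-behind g) (↝*-extend-⟶ t s) t d)

      left-cutᴿ : α ∷ Θ ▷ γ → Γ ↝* Θ → Γ ▷ᴿ δ → Θ ▷ᴿ δ
      left-cutᴿ g s (atomᴿ e x) with s x
      ... | same y = atomᴿ e y
      ... | replaced _ _ with () ← e
      left-cutᴿ g s (conjᴿ e d f) =
        conjᴿ e (left-cut g s keep d) (left-cut g s keep f)
      left-cutᴿ g s (disjᴿ₁ e d) = disjᴿ₁ e (left-cut g s keep d)
      left-cutᴿ g s (disjᴿ₂ e d) = disjᴿ₂ e (left-cut g s keep d)
      left-cutᴿ g s (implᴿ e d)  =
        implᴿ e (left-cut (weaken-behind g) (↝*-extend s) keep d)

  -- Cut by induction on the cut formula

  cut-acc : Acc _≺_ α → CutOn α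
  cut-acc (acc rs) d g =
    left-cut (λ i → principal-cut (λ φ≺α → cut-acc (rs φ≺α)) i id) g same replace d

  cut-▷ : CutOn α
  cut-▷ = cut-acc (≺-wellFounded _)

  -- Translation from the cut-free sequent calculus

  open Equivalence using (to)

  fromSequent : cut-free L ⊢ Γ ⇒ γ → Γ ▷ γ
  fromSequent (infer _ init1 q []) = right (atomᴿ refl (to q (here refl)))
  fromSequent (infer _ init2 q []) = right (atomᴿ refl (to q (here refl)))
  fromSequent (infer (_ , ≢cut) cut _ _) = ⊥-elim (≢cut refl)
  fromSequent (infer _ (⟶left {Γ = Γ} {Δ}) q (d ∷ f ∷ [])) =
    implᴸ (to q (here refl)) refl
      (weaken (to q ∘ there ∘ xs⊆xs++ys Γ Δ) (fromSequent d))
      (weaken (∷⁺ʳ _ (to q ∘ there ∘ xs⊆ys++xs Δ Γ)) (fromSequent f))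
  fromSequent (infer _ ⟶right q (d ∷ [])) =
    right (implᴿ refl (weaken (∷⁺ʳ _ (to q)) (fromSequent d)))
  fromSequent (infer _ ∧left q (d ∷ [])) =
    conjᴸ (to q (here refl)) refl
      (weaken (∷⁺ʳ _ (∷⁺ʳ _ (to q ∘ there))) (fromSequent d))
  fromSequent (infer _ ∧right q (d ∷ f ∷ [])) =
    right (conjᴿ refl (weaken (to q) (fromSequent d)) (weaken (to q) (fromSequent f)))
  fromSequent (infer _ ∨left q (d ∷ f ∷ [])) =
    disjᴸ (to q (here refl)) refl
      (weaken (∷⁺ʳ _ (to q ∘ there)) (fromSequent d))
      (weaken (∷⁺ʳ _ (to q ∘ there)) (fromSequent f))
  fromSequent (infer _ ∨right1 q (d ∷ [])) =
    right (disjᴿ₁ refl (weaken (to q) (fromSequent d)))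
  fromSequent (infer _ ∨right2 q (d ∷ [])) =
    right (disjᴿ₂ refl (weaken (to q) (fromSequent d)))
  fromSequent (infer _ ∼left q (d ∷ [])) =
    conjᴸ (to q (here refl)) refl
      -- The shape `conj α α` of `∼ ∼ α` asks for two copies of `α`; weakening supplies the second.
      (weaken₁ (weaken (∷⁺ʳ _ (to q ∘ there)) (fromSequent d)))
  fromSequent (infer _ ∼right q (d ∷ [])) =
    right (conjᴿ refl (weaken (to q) (fromSequent d)) (weaken (to q) (fromSequent d)))
  fromSequent (infer _ (∼⟶left {Γ = Γ} {Δ}) q (d ∷ f ∷ [])) =
    implᴸ (to q (here refl)) refl
      (weaken (to q ∘ there ∘ xs⊆xs++ys Γ Δ) (fromSequent d))
      (weaken (∷⁺ʳ _ (to q ∘ there ∘ xs⊆ys++xs Δ Γ)) (fromSequent f))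
  fromSequent (infer _ ∼⟶right q (d ∷ [])) =
    right (implᴿ refl (weaken (∷⁺ʳ _ (to q)) (fromSequent d)))
  fromSequent (infer _ ∼∧left q (d ∷ f ∷ [])) =
    disjᴸ (to q (here refl)) refl
      (weaken (∷⁺ʳ _ (to q ∘ there)) (fromSequent d))
      (weaken (∷⁺ʳ _ (to q ∘ there)) (fromSequent f))
  fromSequent (infer _ ∼∧right1 q (d ∷ [])) =
    right (disjᴿ₁ refl (weaken (to q) (fromSequent d)))
  fromSequent (infer _ ∼∧right2 q (d ∷ [])) =
    right (disjᴿ₂ refl (weaken (to q) (fromSequent d)))
  fromSequent (infer _ ∼∨left q (d ∷ [])) =
    conjᴸ (to q (here refl)) refl
      (weaken (∷⁺ʳ _ (∷⁺ʳ _ (to q ∘ there))) (fromSequent d))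
  fromSequent (infer _ ∼∨right q (d ∷ f ∷ [])) =
    right (conjᴿ refl (weaken (to q) (fromSequent d)) (weaken (to q) (fromSequent f)))
  fromSequent (infer (m , _) ex-middle q (d ∷ f ∷ [])) =
    exm m (weaken (∷⁺ʳ _ (to q)) (fromSequent d))
          (weaken (∷⁺ʳ _ (to q)) (fromSequent f))
  fromSequent (infer (m , _) Peirce q (d ∷ [])) =
    prc m (weaken (∷⁺ʳ _ (to q)) (fromSequent d))

  -- Translation back to the cut-free sequent calculus

  private
    base : ∀ {r} → sC r → cut ≢ r → cut-free L r
    base m ≢cut = sC⊆L m , ≢cut

  -- Matching on the formula makes `shape` compute and so selects the rule. The rule adds a copy of
  -- the principal formula, which is already in `Γ` and is absorbed by set equality.
  ⊢-conjᴸ : ∀ α → shape α ≡ conj φ ψ → α ∈ Γ →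
            cut-free L ⊢ φ ∷ ψ ∷ Γ ⇒ γ → cut-free L ⊢ Γ ⇒ γ
  ⊢-conjᴸ (_ ∧ _)     refl x d = infer (base tt λ ()) ∧left (absorb x) (d ∷ [])
  ⊢-conjᴸ (∼ (_ ∨ _)) refl x d = infer (base tt λ ()) ∼∨left (absorb x) (d ∷ [])
  ⊢-conjᴸ (∼ ∼ _)     refl x d = infer (base tt λ ()) ∼left (absorb x)
    (⊢-resp-set (absorb (here refl)) d ∷ [])

  ⊢-disjᴸ : ∀ α → shape α ≡ disj φ ψ → α ∈ Γ →
            cut-free L ⊢ φ ∷ Γ ⇒ γ → cut-free L ⊢ ψ ∷ Γ ⇒ γ →
            cut-free L ⊢ Γ ⇒ γ
  ⊢-disjᴸ (_ ∨ _)     refl x d f =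
    infer (base tt λ ()) ∨left (absorb x) (d ∷ f ∷ [])
  ⊢-disjᴸ (∼ (_ ∧ _)) refl x d f =
    infer (base tt λ ()) ∼∧left (absorb x) (d ∷ f ∷ [])

  ⊢-implᴸ : ∀ α → shape α ≡ impl φ ψ → α ∈ Γ →
            cut-free L ⊢ Γ ⇒ φ → cut-free L ⊢ ψ ∷ Γ ⇒ γ → cut-free L ⊢ Γ ⇒ γ
  ⊢-implᴸ (_ ⟶ _)     refl x d f =
    infer (base tt λ ()) ⟶left (absorb-++ x) (d ∷ f ∷ [])
  ⊢-implᴸ (∼ (_ ⟶ _)) refl x d f =
    infer (base tt λ ()) ∼⟶left (absorb-++ x) (d ∷ f ∷ [])

  ⊢-atom : ∀ γ → shape γ ≡ atom → γ ∈ Γ → cut-free L ⊢ Γ ⇒ γ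
  ⊢-atom (var _)   refl x = infer (base tt λ ()) init1 (absorb x) []
  ⊢-atom (∼ var _) refl x = infer (base tt λ ()) init2 (absorb x) []

  ⊢-conjᴿ : ∀ γ → shape γ ≡ conj φ ψ →
            cut-free L ⊢ Γ ⇒ φ → cut-free L ⊢ Γ ⇒ ψ → cut-free L ⊢ Γ ⇒ γ
  ⊢-conjᴿ (_ ∧ _)     refl d f = infer (base tt λ ()) ∧right K-refl (d ∷ f ∷ [])
  ⊢-conjᴿ (∼ (_ ∨ _)) refl d f = infer (base tt λ ()) ∼∨right K-refl (d ∷ f ∷ [])
  ⊢-conjᴿ (∼ ∼ _)     refl d _ = infer (base tt λ ()) ∼right K-refl (d ∷ [])

  ⊢-disjᴿ₁ : ∀ γ → shape γ ≡ disj φ ψ →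
             cut-free L ⊢ Γ ⇒ φ → cut-free L ⊢ Γ ⇒ γ
  ⊢-disjᴿ₁ (_ ∨ _)     refl d = infer (base tt λ ()) ∨right1 K-refl (d ∷ [])
  ⊢-disjᴿ₁ (∼ (_ ∧ _)) refl d = infer (base tt λ ()) ∼∧right1 K-refl (d ∷ [])

  ⊢-disjᴿ₂ : ∀ γ → shape γ ≡ disj φ ψ →
             cut-free L ⊢ Γ ⇒ ψ → cut-free L ⊢ Γ ⇒ γ
  ⊢-disjᴿ₂ (_ ∨ _)     refl d = infer (base tt λ ()) ∨right2 K-refl (d ∷ [])
  ⊢-disjᴿ₂ (∼ (_ ∧ _)) refl d = infer (base tt λ ()) ∼∧right2 K-refl (d ∷ [])

  ⊢-implᴿ : ∀ γ → shape γ ≡ impl φ ψ →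
            cut-free L ⊢ φ ∷ Γ ⇒ ψ → cut-free L ⊢ Γ ⇒ γ
  ⊢-implᴿ (_ ⟶ _)     refl d = infer (base tt λ ()) ⟶right K-refl (d ∷ [])
  ⊢-implᴿ (∼ (_ ⟶ _)) refl d = infer (base tt λ ()) ∼⟶right K-refl (d ∷ [])

  mutual
    toSequent : Γ ▷ γ → cut-free L ⊢ Γ ⇒ γ
    toSequent (right i)       = toSequentᴿ i
    toSequent (conjᴸ x e d)   = ⊢-conjᴸ _ e x (toSequent d)
    toSequent (disjᴸ x e d f) = ⊢-disjᴸ _ e x (toSequent d) (toSequent f)
    toSequent (implᴸ x e d f) = ⊢-implᴸ _ e x (toSequent d) (toSequent f)
    toSequent (exm m d f)     =
      infer (m , λ ()) ex-middle K-refl (toSequent d ∷ toSequent f ∷ [])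
    toSequent (prc m d)       = infer (m , λ ()) Peirce K-refl (toSequent d ∷ [])

    toSequentᴿ : Γ ▷ᴿ γ → cut-free L ⊢ Γ ⇒ γ
    toSequentᴿ (atomᴿ e x)   = ⊢-atom _ e x
    toSequentᴿ (conjᴿ e d f) = ⊢-conjᴿ _ e (toSequent d) (toSequent f)
    toSequentᴿ (disjᴿ₁ e d)  = ⊢-disjᴿ₁ _ e (toSequent d)
    toSequentᴿ (disjᴿ₂ e d)  = ⊢-disjᴿ₂ _ e (toSequent d)
    toSequentᴿ (implᴿ e d)   = ⊢-implᴿ _ e (toSequent d)

  -- Admissibility of cut

  cut-admissible : Admissible cut (cut-free L)
  cut-admissible (cut {Γ = Γ} {Σ}) (d ∷ f ∷ []) = toSequent
    -- `CutOn` needs one shared context, so both premises are weakened to `Γ ++ Σ`.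
    (cut-▷ (weaken (xs⊆xs++ys Γ Σ) (fromSequent d))
           (weaken (∷⁺ʳ _ (xs⊆ys++xs Σ Γ)) (fromSequent f)))

theorem2p6 : ∀ (L : Calculus) → L ≡ sC3 ⊎ L ≡ sMC ⊎ L ≡ sCN →
    Admissible cut (cut-free L)
theorem2p6 _ (inj₁ refl)        = CutElimination.cut-admissible sC3 inj₁
theorem2p6 _ (inj₂ (inj₁ refl)) = CutElimination.cut-admissible sMC inj₁
theorem2p6 _ (inj₂ (inj₂ refl)) = CutElimination.cut-admissible sCN (inj₁ ∘ inj₁)
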